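{- Let $P$ be a finite lattice and let $M=\mathcal{F}(P)$ be the monoid of all regressive, order-preserving, $1$-level-Lipschitz functions $f:P\to P$, under function composition (with $(fg)(p)=f(g(p))$). Then $X(M)$ is linear if and only if $P$ is a chain of length $1$, $2$ or $3$.
   Context: A function $f:P\to P$ on a poset is regressive if $f(p)\leq p$ for all $p\in P$, and order-preserving if $x\leq y$ implies $f(x)\leq f(y)$. The length of a chain is its number of elements. For $x$ in a finite poset $P$, $\operatorname{level}(x)$ is the maximal length of a chain in $P$ whose maximal element is $x$ (so minimal elements have level $1$). A function $f:P\to P$ is $k$-level-Lipschitz if whenever $x>y$ and $\operatorname{level}(x)=\operatorname{level}(y)+1$, then $|\operatorname{level}(f(x))-\operatorname{level}(f(y))|\leq k$. Finite lattices are nonempty (they have a minimum and a maximum). For a monoid $M$ and $m\in M$, put $mM=\{mx : x\in M\}$. $X(M)=\{mM : m\in M\}$ is viewed as a poset ordered by inclusion; it is linear if any two of its elements are comparable under $\subseteq$. Product convention: $(fg)(p)=f(g(p))$, so $fM=\{f\circ h : h\in M\}$. -}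

module Defs where

open import Algebra.Bundles using (Monoid)
open import Data.Fin.Base using (Fin; zero; suc)
import Data.Fin.Properties as Fin
open import Data.List.Base using ([]; _∷_; length; lookup)
open import Data.List.Membership.Propositional.Properties using (∈-lookup)
open import Data.List.Relation.Unary.All as All using ([]; _∷_)
open import Data.List.Relation.Unary.AllPairs using (AllPairs; []; _∷_)
open import Data.Nat.Base as ℕ using (ℕ; zero; suc; ∣_-_∣; s≤s; z≤n)
import Data.Nat.Properties as ℕ
open import Data.Product.Base using (∃; _×_; _,_; proj₁; proj₂)
open import Function.Base using (id)
open import Function.Bundles using (Inverse)
open import Level using (Level; _⊔_) renaming (suc to lsuc)
open import Relation.Binary.Bundles using (Poset; StrictPartialOrder)
open import Relation.Binary.Definitions using (Decidable; Total)
open import Relation.Binary.Lattice using (Lattice)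
open import Relation.Binary.PropositionalEquality as ≡ using (_≡_)
import Relation.Binary.Construct.NonStrictToStrict as NonStrictToStrict
import Relation.Binary.Properties.Poset as PosetProperties
open import Relation.Nullary using (Dec; yes; no; contradiction)
open import Relation.Nullary.Decidable using (map′; _×-dec_)
open import Relation.Unary using (Pred; _⊆_; _≐_)

private
  variable
    c ℓ ℓ₁ ℓ₂ : Level

rightIdeal : (M : Monoid c ℓ) → Monoid.Carrier M → Pred (Monoid.Carrier M) (c ⊔ ℓ)
rightIdeal M m y = ∃ λ x → y ≈ m ∙ x
  where open Monoid M

-- X(M) = { mM : m ∈ M } under inclusion. The set mM is
-- represented by m, two representatives being equal in X(M) when they
-- generate the same set.
X : Monoid c ℓ → Poset c (c ⊔ ℓ) (c ⊔ ℓ)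
X M = record
  { Carrier        = Monoid.Carrier M
  ; _≈_            = λ m n → rightIdeal M m ≐ rightIdeal M n
  ; _≤_            = λ m n → rightIdeal M m ⊆ rightIdeal M n
  ; isPartialOrder = record
    { isPreorder = record
      { isEquivalence = record
        { refl  = id , id
        ; sym   = λ (p , q) → q , p
        ; trans = λ (p , q) (r , s) → (λ z → r (p z)) , (λ z → q (s z))
        }
      ; reflexive = proj₁
      ; trans     = λ p q z → q (p z)
      }
    ; antisym = _,_
    }
  }

Linear : Poset c ℓ₁ ℓ₂ → Set (c ⊔ ℓ₂)
Linear Q = Total (Poset._≤_ Q)

record FiniteLattice c ℓ₁ ℓ₂ : Set (lsuc (c ⊔ ℓ₁ ⊔ ℓ₂)) where
  field
    lattice : Lattice c ℓ₁ ℓ₂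

  open Lattice lattice public

  field
    size        : ℕ
    enumeration : Inverse (≡.setoid (Fin size)) setoid
    inhabitant  : Carrier

private
  greatest : {Q : ℕ → Set ℓ} → (∀ k → Dec (Q k)) → ∀ b → (∀ j → Q j → j ℕ.≤ b) →
             ∃ Q → ∃ λ k → Q k × (∀ j → Q j → j ℕ.≤ k)
  greatest Q? b bounded ∃Q with Q? b
  ... | yes q = b , q , bounded
  greatest {Q = Q} Q? zero bounded (k , q) | no ¬q =
    contradiction (≡.subst Q (ℕ.n≤0⇒n≡0 (bounded k q)) q) ¬q
  greatest {Q = Q} Q? (suc b) bounded ∃Q | no ¬q = greatest Q? b bounded′ ∃Q
    where
    bounded′ : ∀ j → Q j → j ℕ.≤ b
    bounded′ j q = ℕ.≤-pred (ℕ.≤∧≢⇒< (bounded j q) λ { ≡.refl → ¬q q })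

module _ (P : FiniteLattice c ℓ₁ ℓ₂) where
  open FiniteLattice P
  open PosetProperties poset using (_<_; <-strictPartialOrder; mono⇒cong)
  private
    module < = StrictPartialOrder <-strictPartialOrder
    module E = Inverse enumeration

  -- A chain with maximal element x, listed in strictly decreasing order;
  -- its length is its number of elements.
  ChainBelow : Carrier → ℕ → Set (c ⊔ ℓ₁ ⊔ ℓ₂)
  ChainBelow x k = ∃ λ ys → AllPairs (λ a b → b < a) (x ∷ ys) × length (x ∷ ys) ≡ k

  IsLevel : Carrier → ℕ → Set (c ⊔ ℓ₁ ⊔ ℓ₂)
  IsLevel x k = ChainBelow x k × (∀ j → ChainBelow x j → j ℕ.≤ k)

  infix 4 _≈?_ _≤?_ _<?_

  _≈?_ : Decidable _≈_
  x ≈? y = map′ from-injective E.from-cong (E.from x Fin.≟ E.from y)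
    where
    from-injective : E.from x ≡ E.from y → x ≈ y
    from-injective eq = Eq.trans (Eq.sym (E.strictlyInverseˡ x))
      (Eq.trans (E.to-cong eq) (E.strictlyInverseˡ y))

  _≤?_ : Decidable _≤_
  x ≤? y = map′
    (λ eq → trans (reflexive (Eq.sym eq)) (x∧y≤y x y))
    (λ x≤y → antisym (x∧y≤x x y) (∧-greatest refl x≤y))
    (x ∧ y ≈? x)

  _<?_ : Decidable _<_
  _<?_ = <-decidable _≈?_ _≤?_
    where open NonStrictToStrict _≈_ _≤_ using (<-decidable)

  private
    extend : ∀ {x y k} → y < x → ChainBelow y k → ChainBelow x (suc k)
    extend {y = y} y<x (ys , y>ys ∷ ps , len) =
      y ∷ ys , (y<x ∷ All.map (λ z<y → <.trans z<y y<x) y>ys) ∷ y>ys ∷ ps ,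
      ≡.cong suc len

    chainBelow? : ∀ k x → Dec (ChainBelow x k)
    chainBelow? zero          x = no λ ()
    chainBelow? (suc zero)    x = yes ([] , [] ∷ [] , ≡.refl)
    chainBelow? (suc (suc k)) x = map′
      (λ (i , y<x , ch) → extend y<x ch)
      (λ { (y ∷ ys , (y<x ∷ _) ∷ y>ys ∷ ps , len) →
           let eq = Eq.sym (E.strictlyInverseˡ y) in
           E.from y , <.<-respˡ-≈ eq y<x ,
           ys , All.map (<.<-respʳ-≈ eq) y>ys ∷ ps , ℕ.suc-injective len })
      (Fin.any? λ i → (E.to i <? x) ×-dec chainBelow? (suc k) (E.to i))

    lookup-injective : ∀ {xs} → AllPairs (λ a b → b < a) xs →
      ∀ i j → lookup xs i ≈ lookup xs j → i ≡ j
    lookup-injective (_ ∷ _)  zero    zero    _  = ≡.refl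
    lookup-injective {_ ∷ xs} (p ∷ _) zero (suc j) eq =
      contradiction (All.lookup p (∈-lookup {xs = xs} j)) (<.irrefl (Eq.sym eq))
    lookup-injective {_ ∷ xs} (p ∷ _) (suc i) zero eq =
      contradiction (All.lookup p (∈-lookup {xs = xs} i)) (<.irrefl eq)
    lookup-injective (_ ∷ ps) (suc i) (suc j) eq =
      ≡.cong suc (lookup-injective ps i j eq)

    chainBelow-bounded : ∀ x j → ChainBelow x j → j ℕ.≤ size
    chainBelow-bounded x _ (ys , ps , ≡.refl) =
      Fin.injective⇒≤ {f = λ i → E.from (lookup (x ∷ ys) i)}
        λ {i} {j} eq → lookup-injective ps i j
          (Eq.trans (Eq.sym (E.strictlyInverseˡ _))
            (Eq.trans (E.to-cong eq) (E.strictlyInverseˡ _)))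

  level-exists : ∀ x → ∃ (IsLevel x)
  level-exists x = greatest (λ k → chainBelow? k x) size
    (chainBelow-bounded x) (1 , [] , [] ∷ [] , ≡.refl)

  level : Carrier → ℕ
  level x = proj₁ (level-exists x)

  level-isLevel : ∀ x → IsLevel x (level x)
  level-isLevel x = proj₂ (level-exists x)

  level-mono-< : ∀ {x y} → y < x → level y ℕ.< level x
  level-mono-< {x} {y} y<x =
    proj₂ (level-isLevel x) _ (extend y<x (proj₁ (level-isLevel y)))

  level-cong : ∀ {x y} → x ≈ y → level x ≡ level y
  level-cong x≈y = ℕ.≤-antisym (half x≈y) (half (Eq.sym x≈y))
    where
    half : ∀ {x y} → x ≈ y → level x ℕ.≤ level y
    half {x} {y} x≈y with proj₁ (level-isLevel x)
    ... | ys , x>ys ∷ ps , len = proj₂ (level-isLevel y) _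
      (ys , All.map (<.<-respʳ-≈ x≈y) x>ys ∷ ps , len)

  Regressive : (Carrier → Carrier) → Set (c ⊔ ℓ₂)
  Regressive f = ∀ p → f p ≤ p

  OrderPreserving : (Carrier → Carrier) → Set (c ⊔ ℓ₂)
  OrderPreserving f = ∀ {x y} → x ≤ y → f x ≤ f y

  LevelLipschitz : ℕ → (Carrier → Carrier) → Set (c ⊔ ℓ₁ ⊔ ℓ₂)
  LevelLipschitz k f = ∀ {x y} → y < x → level x ≡ level y ℕ.+ 1 →
    ∣ level (f x) - level (f y) ∣ ℕ.≤ k

  -- Such functions respect _≈_ automatically, being order-preserving.
  record FunctionF : Set (c ⊔ ℓ₁ ⊔ ℓ₂) where
    field
      fun             : Carrier → Carrier
      regressive      : Regressive fun
      orderPreserving : OrderPreserving fun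
      levelLipschitz  : LevelLipschitz 1 fun

    cong : ∀ {x y} → x ≈ y → fun x ≈ fun y
    cong = mono⇒cong orderPreserving

  open FunctionF

  private
    gap : ∀ {m n} → m ℕ.< n → ∣ n - m ∣ ℕ.≤ 1 → n ≡ m ℕ.+ 1
    gap {zero}  {suc zero} _   _ = ≡.refl
    gap {zero}  {suc (suc n)} _ (s≤s ())
    gap {suc m} {suc n} (s≤s m<n) d = ≡.cong suc (gap m<n d)

  idF : FunctionF
  idF .fun x             = x
  idF .regressive p      = refl
  idF .orderPreserving p = p
  idF .levelLipschitz {x} {y} _ eq rewrite eq =
    ℕ.≤-reflexive (≡.trans (ℕ.∣-∣-comm (level y ℕ.+ 1) (level y)) (ℕ.∣m-m+n∣≡n (level y) 1))

  infixr 9 _∘F_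

  _∘F_ : FunctionF → FunctionF → FunctionF
  (f ∘F g) .fun p             = fun f (fun g p)
  (f ∘F g) .regressive p      = trans (regressive f (fun g p)) (regressive g p)
  (f ∘F g) .orderPreserving p = orderPreserving f (orderPreserving g p)
  (f ∘F g) .levelLipschitz {x} {y} y<x eq with fun g y ≈? fun g x
  ... | yes gy≈gx = ℕ.≤-trans
    (ℕ.≤-reflexive (ℕ.m≡n⇒∣m-n∣≡0 (level-cong (cong f (Eq.sym gy≈gx))))) z≤n
  ... | no gy≉gx = levelLipschitz f gy<gx
    (gap (level-mono-< gy<gx) (levelLipschitz g y<x eq))
    where
    gy<gx : fun g y < fun g x
    gy<gx = orderPreserving g (proj₁ y<x) , gy≉gx

  ℱ : Monoid (c ⊔ ℓ₁ ⊔ ℓ₂) (c ⊔ ℓ₁)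
  ℱ = record
    { Carrier  = FunctionF
    ; _≈_      = λ f g → ∀ p → fun f p ≈ fun g p
    ; _∙_      = _∘F_
    ; ε        = idF
    ; isMonoid = record
      { isSemigroup = record
        { isMagma = record
          { isEquivalence = record
            { refl  = λ p → Eq.refl
            ; sym   = λ eq p → Eq.sym (eq p)
            ; trans = λ eq₁ eq₂ p → Eq.trans (eq₁ p) (eq₂ p)
            }
          ; ∙-cong = λ {f} {f′} {g} {g′} f≈f′ g≈g′ p →
              Eq.trans (cong f (g≈g′ p)) (f≈f′ (fun g′ p))
          }
        ; assoc = λ f g h p → Eq.refl
        }
      ; identity = (λ f p → Eq.refl) , (λ f p → Eq.refl)
      }
    }

  IsChainOfLength : ℕ → Set (c ⊔ ℓ₂)
  IsChainOfLength k = Total _≤_ × size ≡ k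

{-# OPTIONS --safe #-}
module Submission where

open import Defs
open import Data.Fin.Base using (Fin; zero; suc; toℕ; fromℕ<)
import Data.Fin.Properties as Fin
open import Data.List.Base using ([]; _∷_)
open import Data.List.Relation.Unary.All using ([]; _∷_)
open import Data.List.Relation.Unary.AllPairs using ([]; _∷_)
open import Data.Nat.Base as ℕ using (ℕ; zero; suc; _⊓_; _⊔_; _∸_; ∣_-_∣; s≤s; z≤n)
import Data.Nat.Properties as ℕ
open import Data.Product.Base using (∃; _×_; _,_; proj₁; proj₂)
open import Data.Sum.Base using (_⊎_; inj₁; inj₂)
open import Function.Base using (_∘_; case_of_)
open import Function.Bundles using (_⇔_; mk⇔; Inverse)
open import Level using (Level)
open import Relation.Binary.Bundles using (Poset)
open import Relation.Binary.Definitions using (Total)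
open import Relation.Binary.PropositionalEquality as ≡ using (_≡_; subst)
import Relation.Binary.Properties.Poset as PosetProperties
open import Relation.Nullary using (¬_; yes; no; contradiction)

-- If X(ℱ(P)) is linear, two elements of equal level are equal, by induction on
-- the level: once levels below level a are unique, p ↦ p ∧ a is
-- 1-level-Lipschitz, and comparability of the ideals of (_∧ a) and (_∧ b) gives
-- comparability of a and b.  Hence P is a chain.  If it had an element of level
-- 4, the ideals of (_∧ a), level a = 2, and of the predecessor map would be
-- incomparable: the first map has only values of level ≤ 2, the second one
-- collapses a.  Conversely, on a chain of length ≤ 3, for distinct f and g one
-- of them fixes every value of the other, so that g = f ∘ g or f = g ∘ f.

private
  ∣n-m∣≤1 : ∀ {m n} → m ℕ.≤ n → n ℕ.≤ suc m → ∣ n - m ∣ ℕ.≤ 1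
  ∣n-m∣≤1 {m} {n} m≤n n≤1+m rewrite ℕ.m≤n⇒∣n-m∣≡n∸m m≤n =
    ℕ.m≤n+o⇒m∸n≤o n m (ℕ.≤-trans n≤1+m (ℕ.≤-reflexive (ℕ.+-comm 1 m)))

module _ {c ℓ₁ ℓ₂} (P : FiniteLattice c ℓ₁ ℓ₂) where
  open FiniteLattice P
  open PosetProperties poset using (_<_)
  open FunctionF
  private
    module E = Inverse enumeration

    ρ : Carrier → ℕ
    ρ = level P

  -- Levels in a finite lattice.

  ρ-mono : ∀ {x y} → x ≤ y → ρ x ℕ.≤ ρ y
  ρ-mono {x} {y} x≤y with _≈?_ P x y
  ... | yes x≈y = ℕ.≤-reflexive (level-cong P x≈y)
  ... | no  x≉y = ℕ.<⇒≤ (level-mono-< P (x≤y , x≉y))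

  ρ-positive : ∀ x → 1 ℕ.≤ ρ x
  ρ-positive x = proj₂ (level-isLevel P x) 1 ([] , [] ∷ [] , ≡.refl)

  ≤∧ρ≥⇒≈ : ∀ {x y} → x ≤ y → ρ y ℕ.≤ ρ x → x ≈ y
  ≤∧ρ≥⇒≈ {x} {y} x≤y ρy≤ρx with _≈?_ P x y
  ... | yes x≈y = x≈y
  ... | no  x≉y = contradiction ρy≤ρx (ℕ.<⇒≱ (level-mono-< P (x≤y , x≉y)))

  -- The second element of a longest chain below `x` works: the rest of that chain bounds its level
  -- from below, and strict monotonicity of levels bounds it from above.
  predecessor : ∀ {x k} → ρ x ≡ suc (suc k) → ∃ λ y → y ≤ x × ρ y ≡ suc k
  predecessor {x} {k} eq with subst (ChainBelow P x) eq (proj₁ (level-isLevel P x))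
  ... | y ∷ ys , (y<x ∷ _) ∷ chain , len = y , proj₁ y<x , ℕ.≤-antisym
    (ℕ.≤-pred (ℕ.≤-trans (level-mono-< P y<x) (ℕ.≤-reflexive eq)))
    (proj₂ (level-isLevel P y) (suc k) (ys , chain , ℕ.suc-injective len))

  descend : ∀ d {m x} → ρ x ≡ d ℕ.+ suc m → ∃ λ y → y ≤ x × ρ y ≡ suc m
  descend zero    {x = x} eq = x , refl , eq
  descend (suc d) {m} {x} eq with predecessor (≡.trans eq (≡.cong suc (ℕ.+-suc d m)))
  ... | y , y≤x , ρy with descend d (≡.trans ρy (≡.sym (ℕ.+-suc d m)))
  ... | z , z≤y , ρz = z , trans z≤y y≤x , ρz

  element-below : ∀ {m} x → 1 ℕ.≤ m → m ℕ.≤ ρ x → ∃ λ y → y ≤ x × ρ y ≡ m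
  element-below x (s≤s _) m≤ρx = descend _ (≡.sym (ℕ.m∸n+n≡m m≤ρx))

  upperBound : ∀ {n} (v : Fin n → Carrier) → ∃ λ u → ∀ i → v i ≤ u
  upperBound {zero}  v = inhabitant , λ ()
  upperBound {suc n} v with upperBound (v ∘ suc)
  ... | u , v≤u = v zero ∨ u , λ
    { zero    → x≤x∨y _ _
    ; (suc i) → trans (v≤u i) (y≤x∨y _ _)
    }

  maximum : ∃ λ t → ∀ x → x ≤ t
  maximum with upperBound E.to
  ... | t , to≤t = t , λ x →
    trans (reflexive (Eq.sym (E.strictlyInverseˡ x))) (to≤t (E.from x))

  LevelUnique : Set _
  LevelUnique = ∀ {x y} → ρ x ≡ ρ y → x ≈ y

  -- If `ρ x ≤ ρ y`, some element below `y` has the level of `x`, and uniqueness makes it `x`.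
  levelUnique⇒total : LevelUnique → Total _≤_
  levelUnique⇒total unique x y = case ℕ.≤-total (ρ x) (ρ y) of λ
    { (inj₁ ρx≤ρy) → inj₁ (below ρx≤ρy)
    ; (inj₂ ρy≤ρx) → inj₂ (below ρy≤ρx)
    }
    where
    below : ∀ {x y} → ρ x ℕ.≤ ρ y → x ≤ y
    below {x} {y} ρx≤ρy with element-below y (ρ-positive x) ρx≤ρy
    ... | z , z≤y , ρz = trans (reflexive (unique (≡.sym ρz))) z≤y

  -- Inclusion of principal right ideals as left divisibility.

  infix 4 _⊑_

  -- Membership of `f` in the ideal of `g`; since the monoid has an identity, this amounts to
  -- inclusion of the ideals.
  _⊑_ : FunctionF P → FunctionF P → Set _
  f ⊑ g = ∃ λ (h : FunctionF P) → ∀ p → fun f p ≈ fun g (fun h p)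

  linear⇒⊑-total : Linear (X (ℱ P)) → Total _⊑_
  linear⇒⊑-total linear f g = case linear f g of λ
    { (inj₁ fM⊆gM) → inj₁ (fM⊆gM {f} (idF P , λ _ → Eq.refl))
    ; (inj₂ gM⊆fM) → inj₂ (gM⊆fM {g} (idF P , λ _ → Eq.refl))
    }

  ⊑-total⇒linear : Total _⊑_ → Linear (X (ℱ P))
  ⊑-total⇒linear total f g = case total f g of λ
    { (inj₁ f⊑g) → inj₁ λ {y} → ideal-⊆ f g f⊑g {y}
    ; (inj₂ g⊑f) → inj₂ λ {y} → ideal-⊆ g f g⊑f {y}
    }
    where
    ideal-⊆ : ∀ f g → f ⊑ g → Poset._≤_ (X (ℱ P)) f g
    ideal-⊆ f g (h , f≈gh) (k , y≈fk) =
      _∘F_ P h k , λ p → Eq.trans (y≈fk p) (f≈gh (fun k p))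

  -- Meets with a fixed element, and uniqueness of levels.

  UniqueBelow : ℕ → Set _
  UniqueBelow n = ∀ {x y} → ρ x ≡ ρ y → ρ x ℕ.< n → x ≈ y

  -- Both y and a have an element of level m below them, and these coincide.
  ρ-∧ : ∀ {a} → UniqueBelow (ρ a) → ∀ {m} y → m ℕ.≤ ρ y → m ℕ.< ρ a → m ℕ.≤ ρ (y ∧ a)
  ρ-∧ unique {zero} y _ _ = z≤n
  ρ-∧ {a} unique {suc m} y m≤ρy m<ρa
    with element-below y (s≤s z≤n) m≤ρy | element-below a (s≤s z≤n) (ℕ.<⇒≤ m<ρa)
  ... | u , u≤y , ρu | v , v≤a , ρv = ℕ.≤-trans (ℕ.≤-reflexive (≡.sym ρu))
    (ρ-mono (∧-greatest u≤y (trans (reflexive u≈v) v≤a)))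
    where
    u≈v : u ≈ v
    u≈v = unique (≡.trans ρu (≡.sym ρv)) (subst (ℕ._< ρ a) (≡.sym ρu) m<ρa)

  -- In a general lattice `p ↦ p ∧ a` may jump by several levels; uniqueness strictly below the
  -- level of `a` prevents this.
  meetF : ∀ a → UniqueBelow (ρ a) → FunctionF P
  meetF a unique .fun p               = p ∧ a
  meetF a unique .regressive p        = x∧y≤x p a
  meetF a unique .orderPreserving x≤y =
    ∧-greatest (trans (x∧y≤x _ a) x≤y) (x∧y≤y _ a)
  meetF a unique .levelLipschitz {x} {y} y<x ρx≡ρy+1 = ∣n-m∣≤1
    (ρ-mono (meetF a unique .orderPreserving (proj₁ y<x)))
    -- With `n = ρ a ∸ 1`, the level of `x ∧ a` is at most `suc (ρ y ⊓ n)`, and `ρ-∧` applies to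
    -- `ρ y ⊓ n` because it is strictly below `ρ a`.
    (ℕ.≤-trans (ℕ.⊓-glb below-x below-a) (s≤s
      (ρ-∧ unique y (ℕ.m⊓n≤m (ρ y) n) (ℕ.≤-<-trans (ℕ.m⊓n≤n (ρ y) n) (ℕ.≤-reflexive 1+n≡ρa)))))
    where
    n : ℕ
    n = ρ a ∸ 1

    1+n≡ρa : suc n ≡ ρ a
    1+n≡ρa = ℕ.m+[n∸m]≡n (ρ-positive a)

    below-x : ρ (x ∧ a) ℕ.≤ suc (ρ y)
    below-x = ℕ.≤-trans (ρ-mono (x∧y≤x x a))
      (ℕ.≤-reflexive (≡.trans ρx≡ρy+1 (ℕ.+-comm (ρ y) 1)))

    below-a : ρ (x ∧ a) ℕ.≤ suc n
    below-a = ℕ.≤-trans (ρ-mono (x∧y≤y x a)) (ℕ.≤-reflexive (≡.sym 1+n≡ρa))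

  -- Evaluation at `a` gives `a ≤ a ∧ a ≈ h a ∧ b ≤ b`.
  meetF-⊑⇒≤ : ∀ {a b} (ua : UniqueBelow (ρ a)) (ub : UniqueBelow (ρ b)) →
    meetF a ua ⊑ meetF b ub → a ≤ b
  meetF-⊑⇒≤ {a} {b} _ _ (h , eq) =
    trans (∧-greatest refl refl) (trans (reflexive (eq a)) (x∧y≤y _ b))

  ⊑-total⇒levelUnique : Total _⊑_ → LevelUnique
  ⊑-total⇒levelUnique ⊑-total {x} ρx≡ρy = uniqueBelow (suc (ρ x)) ρx≡ρy ℕ.≤-refl
    where
    uniqueBelow : ∀ n → UniqueBelow n
    -- Both elements have level at most `n`, so the induction hypothesis puts both meet maps in the
    -- monoid; comparable elements of equal level coincide.
    uniqueBelow (suc n) {x} {y} ρx≡ρy (s≤s ρx≤n) = case ⊑-total (meetF x ux) (meetF y uy) of λ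
      { (inj₁ ⊑) → ≤∧ρ≥⇒≈ (meetF-⊑⇒≤ ux uy ⊑) (ℕ.≤-reflexive (≡.sym ρx≡ρy))
      ; (inj₂ ⊒) → Eq.sym (≤∧ρ≥⇒≈ (meetF-⊑⇒≤ uy ux ⊒) (ℕ.≤-reflexive ρx≡ρy))
      }
      where
      ux : UniqueBelow (ρ x)
      ux eq lt = uniqueBelow n eq (ℕ.<-≤-trans lt ρx≤n)

      uy : UniqueBelow (ρ y)
      uy eq lt = uniqueBelow n eq (ℕ.<-≤-trans lt (subst (ℕ._≤ n) ρx≡ρy ρx≤n))

  -- Chains: the level determines the element.

  module _ (total : Total _≤_) where

    ρ-reflects-≤ : ∀ {x y} → ρ x ℕ.≤ ρ y → x ≤ y
    ρ-reflects-≤ {x} {y} ρx≤ρy = case total x y of λ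
      { (inj₁ x≤y) → x≤y
      ; (inj₂ y≤x) → reflexive (Eq.sym (≤∧ρ≥⇒≈ y≤x ρx≤ρy))
      }

    ρ-injective : LevelUnique
    ρ-injective eq = antisym (ρ-reflects-≤ (ℕ.≤-reflexive eq))
      (ρ-reflects-≤ (ℕ.≤-reflexive (≡.sym eq)))

    -- Two injections between finite sets: an element goes to its level minus one, since levels
    -- start at 1, and `i` goes back to an element of level `i + 1` below the maximum.
    size≡ρ-maximum : size ≡ ρ (proj₁ maximum)
    size≡ρ-maximum = ℕ.≤-antisym
      (Fin.injective⇒≤ {f = λ i → fromℕ< (index< i)} λ {i} {j} eq →
        to-injective (ρ-injective (ℕ.∸-cancelʳ-≡ (ρ-positive _) (ρ-positive _)
          (Fin.fromℕ<-injective _ _ (index< i) (index< j) eq))))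
      (Fin.injective⇒≤ {f = λ i → E.from (proj₁ (element i))} λ {i} {j} eq →
        Fin.toℕ-injective (ℕ.suc-injective (≡.trans (≡.sym (proj₂ (proj₂ (element i))))
          (≡.trans (level-cong P (from-injective eq)) (proj₂ (proj₂ (element j)))))))
      where
      t : Carrier
      t = proj₁ maximum

      index< : ∀ i → ρ (E.to i) ∸ 1 ℕ.< ρ t
      index< i = ℕ.≤-trans (ℕ.≤-reflexive (ℕ.m+[n∸m]≡n (ρ-positive (E.to i))))
        (ρ-mono (proj₂ maximum (E.to i)))

      element : ∀ (i : Fin (ρ t)) → ∃ λ y → y ≤ t × ρ y ≡ suc (toℕ i)
      element i = element-below t (s≤s z≤n) (Fin.toℕ<n i)

      to-injective : ∀ {i j} → E.to i ≈ E.to j → i ≡ j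
      to-injective {i} {j} eq = ≡.trans (≡.sym (E.strictlyInverseʳ i))
        (≡.trans (E.from-cong eq) (E.strictlyInverseʳ j))

      from-injective : ∀ {x y} → E.from x ≡ E.from y → x ≈ y
      from-injective {x} {y} eq = Eq.trans (Eq.sym (E.strictlyInverseˡ x))
        (Eq.trans (E.to-cong eq) (E.strictlyInverseˡ y))

    -- The predecessor map and the bound 3 on levels.

    private
      predOf : ∀ x → ∃ λ y → y ≤ x × ρ y ≡ 1 ⊔ (ρ x ∸ 1)
      predOf x = element-below x (ℕ.m≤m⊔n 1 (ρ x ∸ 1)) (ℕ.⊔-lub (ρ-positive x) (ℕ.m∸n≤m (ρ x) 1))

    -- The bottom element is its own predecessor.
    predF : FunctionF P
    predF .fun x        = proj₁ (predOf x)
    predF .regressive x = proj₁ (proj₂ (predOf x))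
    predF .orderPreserving {x} {y} x≤y = ρ-reflects-≤ (ℕ.≤-trans
      (ℕ.≤-reflexive (proj₂ (proj₂ (predOf x))))
      (ℕ.≤-trans (ℕ.⊔-monoʳ-≤ 1 (ℕ.∸-monoˡ-≤ 1 (ρ-mono x≤y)))
        (ℕ.≤-reflexive (≡.sym (proj₂ (proj₂ (predOf y)))))))
    predF .levelLipschitz {x} {y} y<x ρx≡ρy+1 = ∣n-m∣≤1
      (ρ-mono (predF .orderPreserving (proj₁ y<x)))
      (ℕ.≤-trans (ℕ.≤-reflexive (proj₂ (proj₂ (predOf x))))
        (ℕ.⊔-lub (s≤s z≤n) ρx∸1≤))
      where
      ρx∸1≤ : ρ x ∸ 1 ℕ.≤ suc (ρ (predF .fun y))
      -- After rewriting, the claim is `ρ y ≤ suc (1 ⊔ (ρ y ∸ 1))`.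
      ρx∸1≤ rewrite ρx≡ρy+1 | ℕ.m+n∸n≡m (ρ y) 1 | proj₂ (proj₂ (predOf y)) =
        ℕ.≤-trans (ℕ.m≤n+m∸n (ρ y) 1) (s≤s (ℕ.m≤n⊔m 1 (ρ y ∸ 1)))

    ⊑-total⇒ρ≤3 : Total _⊑_ → ∀ x → ρ x ℕ.≤ 3
    ⊑-total⇒ρ≤3 ⊑-total x = ℕ.≮⇒≥ λ 3<ρx →
      case element-below x (s≤s z≤n) (ℕ.≤-trans (s≤s (s≤s z≤n)) 3<ρx) of λ
        { (a , _ , ρa≡2) → case ⊑-total predF (meetF a λ eq _ → ρ-injective eq) of λ
          { (inj₁ ⊑) → pred⋢meet 3<ρx ρa≡2 ⊑
          ; (inj₂ ⊒) → meet⋢pred ρa≡2 ⊒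
          }
        }
      where
      open ℕ.≤-Reasoning

      -- At `x` the predecessor has level at least 3, but a meet with `a` has level at most 2.
      pred⋢meet : ∀ {a} → 3 ℕ.< ρ x → ρ a ≡ 2 →
        ¬ ∃ λ (h : FunctionF P) → ∀ p → fun predF p ≈ fun h p ∧ a
      pred⋢meet {a} 3<ρx ρa≡2 (h , eq) = ℕ.<-irrefl ≡.refl (begin-strict
        2                  <⟨ ℕ.∸-monoˡ-≤ 1 3<ρx ⟩
        ρ x ∸ 1            ≤⟨ ℕ.m≤n⊔m 1 _ ⟩
        1 ⊔ (ρ x ∸ 1)      ≡⟨ proj₂ (proj₂ (predOf x)) ⟨
        ρ (fun predF x)    ≡⟨ level-cong P (eq x) ⟩
        ρ (fun h x ∧ a)    ≤⟨ ρ-mono (x∧y≤y _ a) ⟩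
        ρ a                ≡⟨ ρa≡2 ⟩
        2                  ∎)

      -- At `a` the left side has level 2, while `h a ≤ a` forces the right side down to level 1.
      meet⋢pred : ∀ {a} → ρ a ≡ 2 →
        ¬ ∃ λ (h : FunctionF P) → ∀ p → p ∧ a ≈ fun predF (fun h p)
      meet⋢pred {a} ρa≡2 (h , eq) = ℕ.<-irrefl ≡.refl (begin-strict
        1                       <⟨ ℕ.≤-refl ⟩
        2                       ≡⟨ ρa≡2 ⟨
        ρ a                     ≤⟨ ρ-mono (∧-greatest refl refl) ⟩
        ρ (a ∧ a)               ≡⟨ level-cong P (eq a) ⟩
        ρ (fun predF (fun h a)) ≤⟨ ρ-mono (orderPreserving predF (regressive h a)) ⟩
        ρ (fun predF a)         ≡⟨ proj₂ (proj₂ (predOf a)) ⟩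
        1 ⊔ (ρ a ∸ 1)           ≡⟨ ≡.cong (λ n → 1 ⊔ (n ∸ 1)) ρa≡2 ⟩
        1                       ∎)

    -- Chains of length at most 3.

    module _ (size≤3 : size ℕ.≤ 3) where
      private
        t : Carrier
        t = proj₁ maximum

        ≤t : ∀ x → x ≤ t
        ≤t = proj₂ maximum

        ρt≤3 : ρ t ℕ.≤ 3
        ρt≤3 = subst (ℕ._≤ 3) size≡ρ-maximum size≤3

        bottom : ∃ λ y → y ≤ t × ρ y ≡ 1
        bottom = element-below t ℕ.≤-refl (ρ-positive t)

        -- The minimum with `ρ t` treats all lengths uniformly: in chains of length 1 or 2 the
        -- middle element coincides with the top.
        middle : ∃ λ y → y ≤ t × ρ y ≡ 2 ⊓ ρ t
        middle = element-below t (ℕ.⊓-glb (s≤s z≤n) (ρ-positive t)) (ℕ.m⊓n≤n 2 (ρ t))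

        o a : Carrier
        o = proj₁ bottom
        a = proj₁ middle

        o≤ : ∀ x → o ≤ x
        o≤ x = ρ-reflects-≤ (ℕ.≤-trans (ℕ.≤-reflexive (proj₂ (proj₂ bottom))) (ρ-positive x))

        ρ≤1⇒≈o : ∀ {x} → ρ x ℕ.≤ 1 → x ≈ o
        ρ≤1⇒≈o {x} ρx≤1 = Eq.sym (≤∧ρ≥⇒≈ (o≤ x)
          (ℕ.≤-trans ρx≤1 (ℕ.≤-reflexive (≡.sym (proj₂ (proj₂ bottom))))))

        ρ≤2⇒≤a : ∀ {x} → ρ x ℕ.≤ 2 → x ≤ a
        ρ≤2⇒≤a {x} ρx≤2 = ρ-reflects-≤ (ℕ.≤-trans (ℕ.⊓-glb ρx≤2 (ρ-mono (≤t x)))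
          (ℕ.≤-reflexive (≡.sym (proj₂ (proj₂ middle)))))

        ≤a⇒≈o⊎≈a : ∀ {x} → x ≤ a → x ≈ o ⊎ x ≈ a
        ≤a⇒≈o⊎≈a {x} x≤a = case ℕ.≤-<-connex (ρ x) 1 of λ
          { (inj₁ ρx≤1) → inj₁ (ρ≤1⇒≈o ρx≤1)
          ; (inj₂ ρx≥2) → inj₂ (≤∧ρ≥⇒≈ x≤a (ℕ.≤-trans
              (ℕ.≤-reflexive (proj₂ (proj₂ middle))) (ℕ.≤-trans (ℕ.m⊓n≤m 2 (ρ t)) ρx≥2)))
          }

        -- Together with `≤a⇒≈o⊎≈a` this leaves only `o`, `a` and `t`, so a map is determined by its
        -- values at `a` and `t`, as `o` is always fixed.
        ≤a⊎≈t : ∀ x → x ≤ a ⊎ x ≈ t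
        ≤a⊎≈t x = case ℕ.≤-<-connex (ρ x) 2 of λ
          { (inj₁ ρx≤2) → inj₁ (ρ≤2⇒≤a ρx≤2)
          ; (inj₂ ρx≥3) → inj₂ (≤∧ρ≥⇒≈ (≤t x) (ℕ.≤-trans ρt≤3 ρx≥3))
          }

        fixes-o : ∀ (f : FunctionF P) → fun f o ≈ o
        fixes-o f = antisym (regressive f o) (o≤ _)

        -- The only use of the Lipschitz condition: it rules out o,a,t ↦ o,o,t.
        fa≈o⇒ft≤a : ∀ (f : FunctionF P) → fun f a ≈ o → fun f t ≤ a
        fa≈o⇒ft≤a f fa≈o = case ℕ.≤-<-connex (ρ t) 2 of λ
          { (inj₁ ρt≤2) → trans (regressive f t) (ρ≤2⇒≤a ρt≤2)
          ; (inj₂ ρt≥3) → ρ≤2⇒≤a (ft-low ρt≥3)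
          }
          where
          ft-low : 3 ℕ.≤ ρ t → ρ (fun f t) ℕ.≤ 2
          ft-low ρt≥3 = ℕ.≤-trans
            (ℕ.m≤n+∣m-n∣ (ρ (fun f t)) (ρ (fun f a)))
            (ℕ.+-mono-≤ (ℕ.≤-reflexive (≡.trans (level-cong P fa≈o) (proj₂ (proj₂ bottom))))
              (levelLipschitz f (proj₁ (proj₂ middle) , a≉t) ρt≡ρa+1))
            where
            ρa≡2 : ρ a ≡ 2
            ρa≡2 = ≡.trans (proj₂ (proj₂ middle)) (ℕ.m≤n⇒m⊓n≡m (ℕ.<⇒≤ ρt≥3))

            ρt≡ρa+1 : ρ t ≡ ρ a ℕ.+ 1
            ρt≡ρa+1 = ≡.trans (ℕ.≤-antisym ρt≤3 ρt≥3) (≡.cong (ℕ._+ 1) (≡.sym ρa≡2))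

            a≉t : ¬ a ≈ t
            a≉t a≈t = ℕ.<⇒≢ ρt≥3 (≡.trans (≡.sym ρa≡2) (level-cong P a≈t))

        fixes-≤a : ∀ (f : FunctionF P) → fun f a ≈ a → ∀ {x} → x ≤ a → fun f x ≈ x
        fixes-≤a f fa≈a x≤a = case ≤a⇒≈o⊎≈a x≤a of λ
          { (inj₁ x≈o) → Eq.trans (cong f x≈o) (Eq.trans (fixes-o f) (Eq.sym x≈o))
          ; (inj₂ x≈a) → Eq.trans (cong f x≈a) (Eq.trans fa≈a (Eq.sym x≈a))
          }

        -- If `f a` were `o`, then `t ≈ f t ≤ a` would give `t ≈ a`, and `a` is fixed after all.
        fixes-t⇒fixes-a : ∀ (f : FunctionF P) → fun f t ≈ t → fun f a ≈ a
        fixes-t⇒fixes-a f ft≈t = case ≤a⇒≈o⊎≈a (regressive f a) of λ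
          { (inj₂ fa≈a) → fa≈a
          ; (inj₁ fa≈o) →
              let t≈a = antisym (trans (reflexive (Eq.sym ft≈t)) (fa≈o⇒ft≤a f fa≈o)) (≤t a)
              in Eq.trans (cong f (Eq.sym t≈a)) (Eq.trans ft≈t t≈a)
          }

        fixes-t⇒fixes : ∀ (f : FunctionF P) → fun f t ≈ t → ∀ x → fun f x ≈ x
        fixes-t⇒fixes f ft≈t x = case ≤a⊎≈t x of λ
          { (inj₁ x≤a) → fixes-≤a f (fixes-t⇒fixes-a f ft≈t) x≤a
          ; (inj₂ x≈t) → Eq.trans (cong f x≈t) (Eq.trans ft≈t (Eq.sym x≈t))
          }

        values-≤ft : ∀ (f : FunctionF P) {y} → fun f t ≤ y → ∀ x → fun f x ≤ y
        values-≤ft f ft≤y x = trans (orderPreserving f (≤t x)) ft≤y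

        fa≈o⇒f≈o : ∀ (f : FunctionF P) → fun f a ≈ o → ∀ {x} → x ≤ a → fun f x ≈ o
        fa≈o⇒f≈o f fa≈o x≤a =
          antisym (trans (orderPreserving f x≤a) (reflexive fa≈o)) (o≤ _)

        -- Such an `f` is constantly `o`, which `g` fixes, so `f = g ∘ f`.
        ft≈o⇒⊑ : ∀ (f g : FunctionF P) → fun f t ≈ o → f ⊑ g
        ft≈o⇒⊑ f g ft≈o = f , λ p →
          let fp≈o = antisym (values-≤ft f (reflexive ft≈o) p) (o≤ _)
          in Eq.trans fp≈o (Eq.sym (Eq.trans (cong g fp≈o) (fixes-o g)))

      -- The cases compare first the values at `t`, then those at `a`. A map that fixes all values
      -- of the other divides it, with the other map itself as the factor.
      size≤3⇒⊑-total : Total _⊑_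
      size≤3⇒⊑-total f g with ≤a⊎≈t (fun f t) | ≤a⊎≈t (fun g t)
      ... | inj₂ ft≈t | _ =
        inj₂ (g , λ p → Eq.sym (fixes-t⇒fixes f ft≈t (fun g p)))
      ... | inj₁ _ | inj₂ gt≈t =
        inj₁ (f , λ p → Eq.sym (fixes-t⇒fixes g gt≈t (fun f p)))
      ... | inj₁ ft≤a | inj₁ gt≤a
        with ≤a⇒≈o⊎≈a (regressive f a) | ≤a⇒≈o⊎≈a (regressive g a)
      ... | inj₂ fa≈a | _ =
        inj₂ (g , λ p → Eq.sym (fixes-≤a f fa≈a (values-≤ft g gt≤a p)))
      ... | inj₁ _ | inj₂ ga≈a =
        inj₁ (f , λ p → Eq.sym (fixes-≤a g ga≈a (values-≤ft f ft≤a p)))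
      ... | inj₁ fa≈o | inj₁ ga≈o with ≤a⇒≈o⊎≈a ft≤a | ≤a⇒≈o⊎≈a gt≤a
      ... | inj₁ ft≈o | _         = inj₁ (ft≈o⇒⊑ f g ft≈o)
      ... | inj₂ _    | inj₁ gt≈o = inj₂ (ft≈o⇒⊑ g f gt≈o)
      -- Both maps send `o`, `a`, `t` to `o`, `o`, `a`; they are equal and the identity is the
      -- factor.
      ... | inj₂ ft≈a | inj₂ gt≈a = inj₁ (idF P , f≈g)
        where
        f≈g : ∀ p → fun f p ≈ fun g p
        f≈g p = case ≤a⊎≈t p of λ
          { (inj₁ p≤a) → Eq.trans (fa≈o⇒f≈o f fa≈o p≤a) (Eq.sym (fa≈o⇒f≈o g ga≈o p≤a))
          ; (inj₂ p≈t) → Eq.trans (cong f p≈t)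
              (Eq.trans (Eq.trans ft≈a (Eq.sym gt≈a)) (cong g (Eq.sym p≈t)))
          }

theorem3p8 : ∀ {c ℓ₁ ℓ₂ : Level} (P : FiniteLattice c ℓ₁ ℓ₂) →
    Linear (X (ℱ P)) ⇔ (IsChainOfLength P 1 ⊎ IsChainOfLength P 2 ⊎ IsChainOfLength P 3)
theorem3p8 P = mk⇔ to from
  where
  to : Linear (X (ℱ P)) → IsChainOfLength P 1 ⊎ IsChainOfLength P 2 ⊎ IsChainOfLength P 3
  -- The length equals the level of the maximum, so the bounds on levels confine it to 1, 2 or 3.
  to linear = split (size≡ρ-maximum P total)
    (ρ-positive P _) (⊑-total⇒ρ≤3 P total ⊑-total (proj₁ (maximum P)))
    where
    ⊑-total : Total (_⊑_ P)
    ⊑-total = linear⇒⊑-total P linear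

    total : Total (FiniteLattice._≤_ P)
    total = levelUnique⇒total P (⊑-total⇒levelUnique P ⊑-total)

    split : ∀ {n} → FiniteLattice.size P ≡ n → 1 ℕ.≤ n → n ℕ.≤ 3 →
      IsChainOfLength P 1 ⊎ IsChainOfLength P 2 ⊎ IsChainOfLength P 3
    split {1} eq _ _ = inj₁ (total , eq)
    split {2} eq _ _ = inj₂ (inj₁ (total , eq))
    split {3} eq _ _ = inj₂ (inj₂ (total , eq))
    split {suc (suc (suc (suc _)))} _ _ (s≤s (s≤s (s≤s ())))

  from : IsChainOfLength P 1 ⊎ IsChainOfLength P 2 ⊎ IsChainOfLength P 3 → Linear (X (ℱ P))
  from (inj₁ (total , eq)) =
    ⊑-total⇒linear P (size≤3⇒⊑-total P total (ℕ.≤-trans (ℕ.≤-reflexive eq) (s≤s z≤n)))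
  from (inj₂ (inj₁ (total , eq))) =
    ⊑-total⇒linear P (size≤3⇒⊑-total P total (ℕ.≤-trans (ℕ.≤-reflexive eq) (s≤s (s≤s z≤n))))
  from (inj₂ (inj₂ (total , eq))) =
    ⊑-total⇒linear P (size≤3⇒⊑-total P total (ℕ.≤-reflexive eq))
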